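{- Let $n\ge 1$ and let $\pi$ be a permutation of length $n$ with exactly $k$ descents. Then $\pi$ is uniquely sorted if and only if $\pi$ is sorted and $n=2k+1$.
   Context: A permutation is an ordering $\pi=\pi_1\cdots\pi_n$ of a finite set of positive integers (each element appearing once), written as a word. A descent of $\pi$ is an index $i\in\{1,\ldots,n-1\}$ with $\pi_i>\pi_{i+1}$. The (West) stack-sorting map $s$ is defined by the following procedure on an input permutation $\pi=\pi_1\cdots\pi_n$, using an initially empty vertical stack. At any point in time, if there is a next entry of the input and either it is smaller than the entry at the top of the stack or the stack is empty, then that next entry is placed on top of the stack. Otherwise, the entry at the top of the stack is removed and appended to the end of the output. The procedure terminates when the output has length $n$, and $s(\pi)$ is this output (a permutation of the same set). The fertility of $\pi$ is $|s^{ -1}(\pi)|$. A permutation is sorted if its fertility is positive, and uniquely sorted if its fertility is $1$. -}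

module Defs where

open import Data.Bool using (if_then_else_; true; false)
open import Data.Fin using (Fin)
open import Data.List using (List; []; _∷_; _++_; length)
open import Data.List.Relation.Binary.Permutation.Propositional
  using (_↭_; ↭-refl; ↭-sym; ↭-trans; prep; ↭⇒↭ₛ)
open import Data.List.Relation.Binary.Permutation.Propositional.Properties
  using (All-resp-↭; shift)
import Data.List.Relation.Binary.Permutation.Setoid.Properties as Permₛ
open import Data.List.Relation.Unary.All using (All)
open import Data.List.Relation.Unary.Unique.Propositional using (Unique)
open import Data.Nat using (ℕ; suc; _<_; _<ᵇ_)
open import Data.Product using (∃-syntax; _×_)
open import Function.Bundles using (_↔_)
open import Relation.Binary.PropositionalEquality using (_≡_; setoid)

-- The two conditions are irrelevant fields, so that permutations are equal
-- as soon as their words are.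
record Permutation : Set where
  constructor perm
  field
    word      : List ℕ
    .positive : All (0 <_) word
    .distinct : Unique word

open Permutation public using (word)

len : Permutation → ℕ
len π = length (word π)

wordDescents : List ℕ → ℕ
wordDescents []           = 0
wordDescents (x ∷ [])     = 0
wordDescents (x ∷ y ∷ xs) =
  if y <ᵇ x then suc (wordDescents (y ∷ xs)) else wordDescents (y ∷ xs)

descents : Permutation → ℕ
descents π = wordDescents (word π)

-- run input stack is the part of the output still to be produced from this
-- state; the head of the second list is the top of the stack.  Both lists are
-- empty exactly when the output has reached the length of the original input.
run : List ℕ → List ℕ → List ℕ
run []       []       = []
run []       (t ∷ st) = t ∷ run [] st
run (x ∷ xs) []       = run xs (x ∷ [])
run (x ∷ xs) (t ∷ st) =
  if x <ᵇ t then run xs (x ∷ t ∷ st) else t ∷ run (x ∷ xs) st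

if-↭ : ∀ b {us vs ws : List ℕ} → us ↭ ws → vs ↭ ws →
       (if b then us else vs) ↭ ws
if-↭ true  p q = p
if-↭ false p q = q

run-↭ : ∀ xs st → run xs st ↭ st ++ xs
run-↭ []       []       = ↭-refl
run-↭ []       (t ∷ st) = prep t (run-↭ [] st)
run-↭ (x ∷ xs) []       = run-↭ xs (x ∷ [])
run-↭ (x ∷ xs) (t ∷ st) = if-↭ (x <ᵇ t)
  (↭-trans (run-↭ xs (x ∷ t ∷ st)) (↭-sym (shift x (t ∷ st) xs)))
  (prep t (run-↭ (x ∷ xs) st))

s : Permutation → Permutation
s (perm w pos dis) = perm (run w [])
  (All-resp-↭ (↭-sym (run-↭ w [])) pos)
  (Permₛ.Unique-resp-↭ (setoid ℕ) (↭⇒↭ₛ (↭-sym (run-↭ w []))) dis)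

s⁻¹ : Permutation → Set
s⁻¹ π = ∃[ σ ] s σ ≡ π

-- Fertility as a relation: the cardinality of s⁻¹ π is m.
HasFertility : Permutation → ℕ → Set
HasFertility π m = s⁻¹ π ↔ Fin m

Sorted : Permutation → Set
Sorted π = ∃[ m ] HasFertility π m × 0 < m

UniquelySorted : Permutation → Set
UniquelySorted π = HasFertility π 1

{-# OPTIONS --safe #-}
-- Writing a permutation σ as σ = L n R around its largest entry gives
-- s(σ) = s(L) s(R) n.  So the preimages of π are the in-order readings of the
-- decreasing binary trees whose postorder reading is π.  At a descent of π the
-- postorder traversal leaves a left subtree and enters its sibling, so such a
-- tree with n nodes satisfies n = 2k + 1 + slack, where slack vanishes exactly
-- when every node has 0 or 2 children and every passage between siblings is a
-- descent.  If slack = 0, the leaves are the first entry and the entries after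
-- the descents, so π determines the tree, as in reverse Polish notation.
-- If slack > 0, a subtree can be moved without changing the postorder reading.
module Submission where

open import Defs
open import Data.Bool using (true; false; if_then_else_)
open import Data.Fin using (Fin; zero; suc; fromℕ<)
open import Data.List using (List; []; _∷_; _++_; _∷ʳ_; length; foldl)
open import Data.List.Extrema.Nat using (xs≤max)
open import Data.List.Properties
  using (++-assoc; ++-identityʳ; ++-cancelˡ; ++-cancelʳ; ++-conicalʳ; ∷-injectiveˡ;
         ∷-injectiveʳ; foldl-++; length-++)
open import Data.List.Relation.Binary.Permutation.Propositional using (_↭_; ↭⇒↭ₛ)
open import Data.List.Relation.Binary.Permutation.Propositional.Properties using (All-resp-↭)
import Data.List.Relation.Binary.Permutation.Setoid.Properties as Permₛ
open import Data.List.Relation.Unary.All as All using (All; []; _∷_)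
import Data.List.Relation.Unary.All.Properties as All
open import Data.List.Relation.Unary.AllPairs using ([]; _∷_)
open import Data.List.Relation.Unary.Unique.Propositional using (Unique)
open import Data.Nat using (ℕ; suc; _+_; _*_; _≤_; _<_; _<ᵇ_; _<?_; _≟_; s≤s; z<s)
open import Data.List.Relation.Unary.Unique.DecPropositional _≟_ using (unique?)
open import Data.Nat.Properties
  using (≤-refl; ≤-trans; <-trans; <⇒≤; <⇒≱; <-irrefl; <-cmp; ≮⇒≥;
         m+n≡0⇒m≡0; m+n≡0⇒n≡0; +-cancelˡ-≡; +-comm; +-identityʳ; +-suc)
open import Data.Nat.Tactic.RingSolver using (solve-∀)
open import Data.Product using (∃-syntax; _×_; _,_; proj₁; proj₂)
open import Data.Sum using (_⊎_; inj₁; inj₂)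
open import Data.Unit using (⊤; tt)
open import Function.Bundles using (_⇔_; mk⇔; mk↔ₛ′; Inverse; Injection)
open import Function.Properties.Inverse using (Inverse⇒Injection)
open import Relation.Binary.Definitions using (tri<; tri≈; tri>)
open import Relation.Binary.PropositionalEquality
  using (_≡_; _≢_; refl; sym; trans; cong; cong₂; subst; setoid; module ≡-Reasoning)
open import Relation.Nullary using (yes; no; contradiction)
open import Relation.Nullary.Decidable using (dec-true; dec-false; recompute)

-- Comparisons and bounds on the first entry

<ᵇ-true : ∀ {m n} → m < n → (m <ᵇ n) ≡ true
<ᵇ-true {m} {n} = dec-true (m <? n)

<ᵇ-false : ∀ {m n} → n ≤ m → (m <ᵇ n) ≡ false
<ᵇ-false {m} {n} n≤m = dec-false (m <? n) (λ m<n → <⇒≱ m<n n≤m)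

infix 4 _≤head_

-- Vacuous on the empty word: an empty stack accepts any push, and exhausted input makes the stack
-- pop.
_≤head_ : ℕ → List ℕ → Set
m ≤head []      = ⊤
m ≤head (x ∷ _) = m ≤ x

≤head-weaken : ∀ {m n} xs → m ≤ n → n ≤head xs → m ≤head xs
≤head-weaken []      m≤n _   = tt
≤head-weaken (x ∷ _) m≤n n≤x = ≤-trans m≤n n≤x

≤head-++ˡ : ∀ {m} xs {ys} → m ≤head (xs ++ ys) → m ≤head xs
≤head-++ˡ []      _   = tt
≤head-++ˡ (_ ∷ _) m≤x = m≤x

≤head-∷ʳ : ∀ {m y} xs → All (_< y) xs → m ≤head (xs ∷ʳ y) → m ≤ y
≤head-∷ʳ []      []        m≤y = m≤y
≤head-∷ʳ (_ ∷ _) (x<y ∷ _) m≤x = ≤-trans m≤x (<⇒≤ x<y)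

-- Decreasing binary trees

data Tree (b : ℕ) : Set where
  nil  : Tree b
  node : ∀ x → x < b → Tree x → Tree x → Tree b

private variable
  b : ℕ

inorder : Tree b → List ℕ
inorder nil            = []
inorder (node x _ l r) = inorder l ++ x ∷ inorder r

postorder : Tree b → List ℕ
postorder nil            = []
postorder (node x _ l r) = (postorder l ++ postorder r) ∷ʳ x

inorder-< : (t : Tree b) → All (_< b) (inorder t)
inorder-< nil              = []
inorder-< (node x x<b l r) = All.++⁺
  (All.map (λ y<x → <-trans y<x x<b) (inorder-< l))
  (x<b ∷ All.map (λ y<x → <-trans y<x x<b) (inorder-< r))

postorder-< : (t : Tree b) → All (_< b) (postorder t)
children-< : ∀ {x} (l r : Tree x) → All (_< x) (postorder l ++ postorder r)

postorder-< nil              = []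
postorder-< (node x x<b l r) =
  All.∷ʳ⁺ (All.map (λ y<x → <-trans y<x x<b) (children-< l r)) x<b

children-< l r = All.++⁺ (postorder-< l) (postorder-< r)

-- Preimages under the stack-sorting map

run-push : ∀ x xs st → suc x ≤head st → run (x ∷ xs) st ≡ run xs (x ∷ st)
run-push x xs []      _ = refl
run-push x xs (t ∷ _) x<t rewrite <ᵇ-true x<t = refl

run-pop : ∀ x xs st → x ≤head xs → run xs (x ∷ st) ≡ x ∷ run xs st
run-pop x []      st _ = refl
run-pop x (y ∷ _) st x≤y rewrite <ᵇ-false x≤y = refl

-- The bounds isolate the tree: its entries never pop `st`, and all of them leave before `xs` is
-- read. Likewise `l` has left when `x` is pushed, and `x` waits beneath `r`.
run-inorder-++ : (t : Tree b) → ∀ xs st → b ≤head xs → b ≤head st →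
  run (inorder t ++ xs) st ≡ postorder t ++ run xs st
run-inorder-++ nil xs st _ _ = refl
run-inorder-++ (node x x<b l r) xs st b≤xs b≤st = begin
  run ((inorder l ++ x ∷ inorder r) ++ xs) st
    ≡⟨ cong (λ ws → run ws st) (++-assoc (inorder l) _ xs) ⟩
  run (inorder l ++ x ∷ inorder r ++ xs) st
    ≡⟨ run-inorder-++ l _ st ≤-refl (≤head-weaken st (<⇒≤ x<b) b≤st) ⟩
  postorder l ++ run (x ∷ inorder r ++ xs) st
    ≡⟨ cong (postorder l ++_) (run-push x _ st (≤head-weaken st x<b b≤st)) ⟩
  postorder l ++ run (inorder r ++ xs) (x ∷ st)
    ≡⟨ cong (postorder l ++_) (run-inorder-++ r xs (x ∷ st) x≤xs ≤-refl) ⟩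
  postorder l ++ postorder r ++ run xs (x ∷ st)
    ≡⟨ cong (λ ws → postorder l ++ postorder r ++ ws) (run-pop x xs st x≤xs) ⟩
  postorder l ++ postorder r ++ x ∷ run xs st
    ≡⟨ ++-assoc (postorder l) _ _ ⟨
  (postorder l ++ postorder r) ++ x ∷ run xs st
    ≡⟨ ++-assoc (postorder l ++ postorder r) _ _ ⟨
  ((postorder l ++ postorder r) ∷ʳ x) ++ run xs st ∎
  where
  open ≡-Reasoning
  x≤xs = ≤head-weaken xs (<⇒≤ x<b) b≤xs

run-inorder : (t : Tree b) → run (inorder t) [] ≡ postorder t
run-inorder t = begin
  run (inorder t) []       ≡⟨ cong (λ ws → run ws []) (++-identityʳ (inorder t)) ⟨
  run (inorder t ++ []) [] ≡⟨ run-inorder-++ t [] [] tt tt ⟩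
  postorder t ++ []        ≡⟨ ++-identityʳ (postorder t) ⟩
  postorder t              ∎
  where open ≡-Reasoning

-- To come first in order, `x` enters on the left spine, above the first root smaller than it, if
-- any, which becomes its right child.
insert : ∀ x → x < b → (t : Tree b) → All (x ≢_) (inorder t) →
  ∃[ t′ ] inorder {b} t′ ≡ x ∷ inorder t
insert x x<b nil _ = node x x<b nil nil , refl
insert x x<b (node y y<b l r) x∉ with <-cmp x y
... | tri< x<y _ _ = let l′ , eq = insert x x<y l (All.++⁻ˡ (inorder l) x∉) in
  node y y<b l′ r , cong (_++ y ∷ inorder r) eq
... | tri≈ _ x≡y _ = contradiction x≡y (All.head (All.++⁻ʳ (inorder l) x∉))
... | tri> _ _ y<x = node x x<b nil (node y y<x l r) , refl

inorder-surjective : ∀ {w} → All (_< b) w → Unique w → ∃[ t ] inorder {b} t ≡ w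
inorder-surjective []          []        = nil , refl
inorder-surjective (x<b ∷ w<b) (x∉ ∷ w!) with inorder-surjective w<b w!
... | t , refl = insert _ x<b t x∉

-- Moving subtrees

-- The left end of the left spine of r is the place for a new subtree whose
-- postorder reading comes immediately before that of r.
graft : ∀ a → a < b → (ll lr : Tree a) (r : Tree b) → suc a ≤head postorder r →
  ∃[ t ] postorder {b} t ≡ ((postorder ll ++ postorder lr) ∷ʳ a) ++ postorder r
graft a a<b ll lr nil _ = node a a<b ll lr , sym (++-identityʳ _)
graft a a<b ll lr (node y y<b l r) a<head =
  let l′ , eq = graft a a<y ll lr l (≤head-++ˡ (postorder l) (≤head-++ˡ _ a<head)) in
  node y y<b l′ r , (begin
    (postorder l′ ++ postorder r) ∷ʳ y
      ≡⟨ cong (λ ws → (ws ++ postorder r) ∷ʳ y) eq ⟩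
    ((ps ++ postorder l) ++ postorder r) ∷ʳ y
      ≡⟨ cong (_∷ʳ y) (++-assoc ps _ _) ⟩
    (ps ++ postorder l ++ postorder r) ∷ʳ y
      ≡⟨ ++-assoc ps _ _ ⟩
    ps ++ (postorder l ++ postorder r) ∷ʳ y ∎)
  where
  open ≡-Reasoning
  ps  = (postorder ll ++ postorder lr) ∷ʳ a
  -- The first letter is a descendant of `y` or `y` itself.
  a<y = ≤head-∷ʳ _ (children-< l r) a<head

-- In-order readings are compared because they are the preimages.
Loose : Tree b → Set
Loose {b} t = ∃[ t′ ] postorder {b} t′ ≡ postorder t × inorder t′ ≢ inorder t

-- Shows that a move changes the in-order reading: without a left child the root comes first, with
-- one a smaller entry does.
inorder-head-≢ : ∀ {x a us vs} (a<x : a < x) (l r : Tree a) →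
  inorder (node {x} a a<x l r) ++ us ≢ x ∷ vs
inorder-head-≢ {x} {a} a<x l r eq
  with inorder (node {x} a a<x l r) in word | inorder-< (node {x} a a<x l r)
... | []    | _       = contradiction (++-conicalʳ (inorder l) _ word) λ ()
... | c ∷ _ | c<x ∷ _ = <-irrefl (∷-injectiveˡ eq) c<x

loose-left : ∀ {x} (x<b : x < b) (l r : Tree x) → Loose l → Loose (node {b} x x<b l r)
loose-left {x = x} x<b l r (l′ , same , ≢) =
  node x x<b l′ r , cong (λ ws → (ws ++ postorder r) ∷ʳ x) same ,
  λ eq → ≢ (++-cancelʳ _ _ _ eq)

loose-right : ∀ {x} (x<b : x < b) (l r : Tree x) → Loose r → Loose (node {b} x x<b l r)
loose-right {x = x} x<b l r (r′ , same , ≢) =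
  node x x<b l r′ , cong (λ ws → (postorder l ++ ws) ∷ʳ x) same ,
  λ eq → ≢ (∷-injectiveʳ (++-cancelˡ (inorder l) _ _ eq))

-- A branching node without a descent between its children costs one descent,
-- that is 2 in n = 2k + 1 + slack.
rise : ℕ → List ℕ → ℕ
rise a []      = 0
rise a (g ∷ _) = if a <ᵇ g then 2 else 0

slack : Tree b → ℕ
slack nil                           = 0
slack (node _ _ nil nil)            = 0
slack (node _ _ nil r)              = suc (slack r)
slack (node _ _ l nil)              = suc (slack l)
slack (node _ _ l@(node a _ _ _) r) = rise a (postorder r) + (slack l + slack r)

rise-zero? : ∀ a xs → rise a xs ≡ 0 ⊎ suc a ≤head xs
rise-zero? a []      = inj₁ refl
rise-zero? a (g ∷ _) with a <? g
... | yes a<g = inj₂ a<g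
... | no  a≮g rewrite <ᵇ-false (≮⇒≥ a≮g) = inj₁ refl

slack-zero? : (t : Tree b) → slack t ≡ 0 ⊎ Loose t
slack-zero? nil                  = inj₁ refl
slack-zero? (node x x<b nil nil) = inj₁ refl
-- A single child can switch sides.
slack-zero? (node x x<b nil r@(node _ c<x rl rr)) = inj₂
  (node x x<b r nil , cong (_∷ʳ x) (++-identityʳ (postorder r)) , inorder-head-≢ c<x rl rr)
slack-zero? (node x x<b l@(node _ a<x ll lr) nil) = inj₂
  (node x x<b nil l , cong (_∷ʳ x) (sym (++-identityʳ (postorder l))) ,
   λ eq → inorder-head-≢ a<x ll lr (sym eq))
slack-zero? (node x x<b l@(node a a<x ll lr) r@(node _ _ _ _))
  with rise-zero? a (postorder r) | slack-zero? l | slack-zero? r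
-- Without a descent between the children, `l` can be grafted into `r`, leaving `x` only a right
-- child.
... | inj₂ a<head | _ | _ = let r′ , eq = graft a a<x ll lr r a<head in inj₂
  (node x x<b nil r′ , cong (_∷ʳ x) eq , λ eq → inorder-head-≢ a<x ll lr (sym eq))
... | inj₁ _  | inj₂ l~ | _       = inj₂ (loose-left x<b l r l~)
... | inj₁ _  | inj₁ _  | inj₂ r~ = inj₂ (loose-right x<b l r r~)
... | inj₁ p  | inj₁ q  | inj₁ q′ = inj₁ (cong₂ _+_ p (cong₂ _+_ q q′))

-- Recovering a tree without slack

-- Shift-reduce parser for postorder words: a stack entry holds the root and the
-- in-order reading of a tree.  The top root is the preceding letter, so a letter
-- that is not larger starts a new leaf.
shift : List (ℕ × List ℕ) → ℕ → List (ℕ × List ℕ)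
shift ((c , vs) ∷ (a , us) ∷ st) x =
  if c <ᵇ x then (x , us ++ x ∷ vs) ∷ st else (x , x ∷ []) ∷ (c , vs) ∷ (a , us) ∷ st
shift st x = (x , x ∷ []) ∷ st

-- Makes the first letter of the word start a leaf instead of closing a node.
Falls : List ℕ → List (ℕ × List ℕ) → Set
Falls (g ∷ _) ((c , _) ∷ _) = g ≤ c
Falls _       _             = ⊤

falls-++ˡ : ∀ xs {ys} st → Falls (xs ++ ys) st → Falls xs st
falls-++ˡ []      _       _ = tt
falls-++ˡ (_ ∷ _) []      _ = tt
falls-++ˡ (_ ∷ _) (_ ∷ _) p = p

rise-falls : ∀ a xs {us st} → rise a xs ≡ 0 → Falls xs ((a , us) ∷ st)
rise-falls a []      _ = tt
rise-falls a (g ∷ _) eq with a <? g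
... | no  a≮g = ≮⇒≥ a≮g
... | yes a<g rewrite <ᵇ-true a<g = contradiction eq λ ()

shift-leaf : ∀ x st → Falls (x ∷ []) st → shift st x ≡ (x , x ∷ []) ∷ st
shift-leaf x []          _ = refl
shift-leaf x (_ ∷ [])    _ = refl
shift-leaf x (_ ∷ _ ∷ _) x≤c rewrite <ᵇ-false x≤c = refl

shift-node : ∀ {a c x us vs} st → c < x →
  shift ((c , vs) ∷ (a , us) ∷ st) x ≡ (x , us ++ x ∷ vs) ∷ st
shift-node st c<x rewrite <ᵇ-true c<x = refl

-- Parsing `l` leaves its root `a` on top. As `rise` vanishes, `r` then starts with a new leaf, and
-- finally `x` exceeds the root of `r` and joins the two entries.
parse-postorder : ∀ x (x<b : x < b) l r st → let t = node {b} x x<b l r in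
  slack t ≡ 0 → Falls (postorder t) st → foldl shift st (postorder t) ≡ (x , inorder t) ∷ st
parse-postorder x x<b nil nil st _ falls = shift-leaf x st falls
parse-postorder x x<b l@(node a a<x ll lr) r@(node c c<x rl rr) st tight falls = begin
  foldl shift st ((postorder l ++ postorder r) ∷ʳ x)
    ≡⟨ foldl-++ shift st (postorder l ++ postorder r) _ ⟩
  shift (foldl shift st (postorder l ++ postorder r)) x
    ≡⟨ cong (λ st → shift st x) (foldl-++ shift st (postorder l) _) ⟩
  shift (foldl shift (foldl shift st (postorder l)) (postorder r)) x
    ≡⟨ cong (λ st → shift (foldl shift st (postorder r)) x)
         (parse-postorder a a<x ll lr st (m+n≡0⇒m≡0 (slack l) lr-tight)
           (falls-++ˡ (postorder l) st (falls-++ˡ _ st falls))) ⟩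
  shift (foldl shift ((a , inorder l) ∷ st) (postorder r)) x
    ≡⟨ cong (λ st → shift st x)
         (parse-postorder c c<x rl rr _ (m+n≡0⇒n≡0 (slack l) lr-tight)
           (rise-falls a (postorder r) (m+n≡0⇒m≡0 (rise a (postorder r)) tight))) ⟩
  shift ((c , inorder r) ∷ (a , inorder l) ∷ st) x
    ≡⟨ shift-node st c<x ⟩
  (x , inorder l ++ x ∷ inorder r) ∷ st ∎
  where
  open ≡-Reasoning
  lr-tight : slack l + slack r ≡ 0
  lr-tight = m+n≡0⇒n≡0 (rise a (postorder r)) tight

falls-[] : ∀ xs → Falls xs []
falls-[] []      = tt
falls-[] (_ ∷ _) = tt

-- The parser sees only the word, so the bounds of the two trees may differ.
postorder-injective : ∀ {b b′} (t : Tree b) (t′ : Tree b′) → slack t ≡ 0 → slack t′ ≡ 0 →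
  postorder t ≡ postorder t′ → inorder t ≡ inorder t′
postorder-injective nil nil _ _ _ = refl
postorder-injective nil (node _ _ l r) _ _ eq =
  contradiction (++-conicalʳ (postorder l ++ postorder r) _ (sym eq)) λ ()
postorder-injective (node _ _ l r) nil _ _ eq =
  contradiction (++-conicalʳ (postorder l ++ postorder r) _ eq) λ ()
postorder-injective t@(node x x<b l r) t′@(node x′ x<b′ l′ r′) tight tight′ eq =
  cong proj₂ (∷-injectiveˡ (trans
    (sym (parse-postorder x x<b l r [] tight (falls-[] (postorder t))))
    (trans (cong (foldl shift []) eq)
      (parse-postorder x′ x<b′ l′ r′ [] tight′ (falls-[] (postorder t′))))))

-- Counting descents

-- Entries of a tree may repeat; with ties counted as descents the length formula
-- below needs no distinctness.
weakDescents : List ℕ → ℕ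
weakDescents []           = 0
weakDescents (x ∷ [])     = 0
weakDescents (x ∷ y ∷ xs) =
  if x <ᵇ y then weakDescents (y ∷ xs) else suc (weakDescents (y ∷ xs))

weakDescents-unique : ∀ {xs} → Unique xs → weakDescents xs ≡ wordDescents xs
weakDescents-unique []       = refl
weakDescents-unique (_ ∷ []) = refl
weakDescents-unique {x ∷ y ∷ _} ((x≢y ∷ _) ∷ u) with <-cmp x y | weakDescents-unique u
... | tri< x<y _ _ | ih rewrite <ᵇ-true x<y | <ᵇ-false (<⇒≤ x<y) = ih
... | tri≈ _ x≡y _ | _  = contradiction x≡y x≢y
... | tri> _ _ y<x | ih rewrite <ᵇ-true y<x | <ᵇ-false (<⇒≤ y<x) = cong suc ih

weakDescents-∷ʳ-max : ∀ {x} xs → All (_< x) xs → weakDescents (xs ∷ʳ x) ≡ weakDescents xs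
weakDescents-∷ʳ-max []       _          = refl
weakDescents-∷ʳ-max (a ∷ []) (a<x ∷ []) rewrite <ᵇ-true a<x = refl
weakDescents-∷ʳ-max (a ∷ c ∷ xs) (_ ∷ c∷xs<x) with a <ᵇ c
... | true  = weakDescents-∷ʳ-max (c ∷ xs) c∷xs<x
... | false = cong suc (weakDescents-∷ʳ-max (c ∷ xs) c∷xs<x)

suc-descents : ∀ d e f {r} → 2 * d + r ≡ 2 * e + f + 2 → 2 * suc d + r ≡ 2 * suc e + f + 2
suc-descents d e f {r} eq = trans (lhs d r) (trans (cong (2 +_) eq) (rhs e f))
  where
  lhs : ∀ d r → 2 * suc d + r ≡ 2 + (2 * d + r)
  lhs = solve-∀
  rhs : ∀ e f → 2 + (2 * e + f + 2) ≡ 2 * suc e + f + 2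
  rhs = solve-∀

-- The junction contributes 2 minus `rise` to the doubled count; `rise` stands on the left to avoid
-- subtraction.
weakDescents-++ : ∀ ws a {vs} → vs ≢ [] →
  2 * weakDescents ((ws ∷ʳ a) ++ vs) + rise a vs ≡
  2 * weakDescents (ws ∷ʳ a) + 2 * weakDescents vs + 2
weakDescents-++ ws a {[]} vs≢[] = contradiction refl vs≢[]
weakDescents-++ [] a {g ∷ vs} _ with a <ᵇ g
... | true  = refl
... | false = identity (weakDescents (g ∷ vs))
  where
  identity : ∀ d → 2 * suc d + 0 ≡ 2 * d + 2
  identity = solve-∀
weakDescents-++ (y ∷ []) a {vs@(_ ∷ _)} vs≢[]
  with y <ᵇ a | weakDescents-++ [] a vs≢[]
... | true  | ih = ih
-- The `0` counts the descents of the one-letter word `a`.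
... | false | ih = suc-descents (weakDescents (a ∷ vs)) 0 (2 * weakDescents vs) ih
weakDescents-++ (y ∷ z ∷ ws) a {vs@(_ ∷ _)} vs≢[]
  with y <ᵇ z | weakDescents-++ (z ∷ ws) a vs≢[]
... | true  | ih = ih
... | false | ih = suc-descents (weakDescents (z ∷ (ws ∷ʳ a) ++ vs))
  (weakDescents (z ∷ ws ∷ʳ a)) (2 * weakDescents vs) ih

length-∷ʳ : ∀ (xs : List ℕ) x → length (xs ∷ʳ x) ≡ suc (length xs)
length-∷ʳ xs x = trans (length-++ xs) (+-comm (length xs) 1)

-- The root adds a letter but, being last and largest, no descent. With one child this letter is
-- slack; with two, it and the two constants 1 make up the new constant 1 and the 2 that the
-- junction takes.
length-postorder : ∀ x (x<b : x < b) l r → let t = node {b} x x<b l r in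
  length (postorder t) ≡ 2 * weakDescents (postorder t) + 1 + slack t
length-postorder x x<b nil nil = refl
length-postorder x x<b nil r@(node c c<x rl rr)
  rewrite length-∷ʳ (postorder r) x
        | weakDescents-∷ʳ-max (postorder r) (postorder-< r)
  = trans (cong suc (length-postorder c c<x rl rr)) (sym (+-suc _ (slack r)))
length-postorder x x<b l@(node a a<x ll lr) nil
  rewrite ++-identityʳ (postorder l)
        | length-∷ʳ (postorder l) x
        | weakDescents-∷ʳ-max (postorder l) (postorder-< l)
  = trans (cong suc (length-postorder a a<x ll lr)) (sym (+-suc _ (slack l)))
length-postorder x x<b l@(node a a<x ll lr) r@(node c c<x rl rr) = begin
  length ((postorder l ++ postorder r) ∷ʳ x)
    ≡⟨ length-∷ʳ (postorder l ++ postorder r) x ⟩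
  suc (length (postorder l ++ postorder r))
    ≡⟨ cong suc (length-++ (postorder l)) ⟩
  suc (length (postorder l) + length (postorder r))
    ≡⟨ cong suc (cong₂ _+_ (length-postorder a a<x ll lr) (length-postorder c c<x rl rr)) ⟩
  suc ((2 * dₗ + 1 + slack l) + (2 * dᵣ + 1 + slack r))
    ≡⟨ lhs dₗ dᵣ (slack l) (slack r) ⟩
  (2 * dₗ + 2 * dᵣ + 2) + (1 + (slack l + slack r))
    ≡⟨ cong (_+ (1 + (slack l + slack r)))
         (weakDescents-++ (postorder ll ++ postorder lr) a r≢[]) ⟨
  (2 * d + ρ) + (1 + (slack l + slack r))
    ≡⟨ rhs d ρ (slack l + slack r) ⟩
  2 * d + 1 + (ρ + (slack l + slack r))
    ≡⟨ cong (λ d → 2 * d + 1 + (ρ + (slack l + slack r)))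
         (weakDescents-∷ʳ-max (postorder l ++ postorder r) (children-< l r)) ⟨
  2 * weakDescents ((postorder l ++ postorder r) ∷ʳ x) + 1 + (ρ + (slack l + slack r)) ∎
  where
  open ≡-Reasoning
  dₗ = weakDescents (postorder l)
  dᵣ = weakDescents (postorder r)
  d  = weakDescents (postorder l ++ postorder r)
  ρ  = rise a (postorder r)
  r≢[] : postorder r ≢ []
  r≢[] eq = contradiction (++-conicalʳ (postorder rl ++ postorder rr) _ eq) λ ()
  lhs : ∀ e f p q → suc ((2 * e + 1 + p) + (2 * f + 1 + q)) ≡ (2 * e + 2 * f + 2) + (1 + (p + q))
  lhs = solve-∀
  rhs : ∀ d ρ p → (2 * d + ρ) + (1 + p) ≡ 2 * d + 1 + (ρ + p)
  rhs = solve-∀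

-- Fibres of the stack-sorting map

-- Decidability turns the irrelevant field into a usable proof.
word-unique : ∀ π → Unique (word π)
word-unique (perm w _ w!) = recompute (unique? w) w!

word-injective : ∀ {σ τ} → word σ ≡ word τ → σ ≡ τ
word-injective refl = refl

-- The equations in the two pairs agree by uniqueness of identity proofs.
preimage-≡ : ∀ {π} (p q : s⁻¹ π) → word (proj₁ p) ≡ word (proj₁ q) → p ≡ q
preimage-≡ (σ , e) (τ , e′) eq with word-injective {σ} {τ} eq
preimage-≡ (σ , refl) (.σ , refl) eq | refl = refl

preimage-tree : ∀ {π} (p : s⁻¹ π) →
  ∃[ b ] ∃[ t ] inorder {b} t ≡ word (proj₁ p) × postorder t ≡ word π
preimage-tree (σ , refl)
  -- Bounds on trees are strict, so one more than the maximum is taken.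
  with inorder-surjective (All.map s≤s (xs≤max 0 (word σ))) (word-unique σ)
... | t , eq = _ , t , eq , trans (sym (run-inorder t)) (cong (λ w → run w []) eq)

-- Positivity and distinctness pass from `π` to the in-order reading, since sorting only permutes
-- entries.
tree-preimage : ∀ π (t : Tree b) → postorder t ≡ word π →
  ∃[ p ] word (proj₁ {B = λ σ → s σ ≡ π} p) ≡ inorder t
tree-preimage π@(perm w pos dis) t eq =
  (perm (inorder t) (All-resp-↭ image pos) (Permₛ.Unique-resp-↭ (setoid ℕ) (↭⇒↭ₛ image) dis) ,
   word-injective sorts) , refl
  where
  sorts : run (inorder t) [] ≡ w
  sorts = trans (run-inorder t) eq
  image : w ↭ inorder t
  image = subst (_↭ inorder t) sorts (run-↭ (inorder t) [])

length-tight : ∀ π (t : Tree b) → postorder t ≡ word π → 1 ≤ len π →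
  len π ≡ 2 * descents π + 1 + slack t
length-tight π nil            eq 1≤n = contradiction (cong length eq) λ 0≡n → <-irrefl 0≡n 1≤n
length-tight π (node x p l r) eq _   = trans (cong length (sym eq)) (trans
  (length-postorder x p l r)
  (cong (λ d → 2 * d + 1 + slack (node x p l r))
    (trans (cong weakDescents eq) (weakDescents-unique (word-unique π)))))

proposition3p3 : ∀ (n k : ℕ) → 1 ≤ n → (π : Permutation) → len π ≡ n → descents π ≡ k →
    UniquelySorted π ⇔ (Sorted π × n ≡ 2 * k + 1)
proposition3p3 n k 1≤n π refl refl = mk⇔ to from
  where
  to : UniquelySorted π → Sorted π × len π ≡ 2 * descents π + 1
  to unique with preimage-tree (Inverse.from unique zero)
  ... | _ , t , _ , eq = (1 , unique , z<s) , size (slack-zero? t)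
    where
    all-equal : (p q : s⁻¹ π) → p ≡ q
    all-equal p q = Injection.injective (Inverse⇒Injection unique)
      (fin1 (Inverse.to unique p) (Inverse.to unique q))
      where
      fin1 : (i j : Fin 1) → i ≡ j
      fin1 zero zero = refl
    size : slack t ≡ 0 ⊎ Loose t → len π ≡ 2 * descents π + 1
    size (inj₁ tight) = trans (length-tight π t eq 1≤n)
      (trans (cong (2 * descents π + 1 +_) tight) (+-identityʳ _))
    -- The readings of `t` and `t′` would be two different preimages.
    size (inj₂ (t′ , same , differ)) =
      let p  , p-word = tree-preimage π t eq
          p′ , p′-word = tree-preimage π t′ (trans same eq)
      in contradiction
           (trans (sym p′-word) (trans (cong (λ q → word (proj₁ q)) (all-equal p′ p)) p-word))
           differ

  from : Sorted π × len π ≡ 2 * descents π + 1 → UniquelySorted π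
  from ((m , fertility , 0<m) , size) =
    mk↔ₛ′ (λ _ → zero) (λ _ → p) (λ { zero → refl ; (suc ()) }) (all-equal p)
    where
    p = Inverse.from fertility (fromℕ< 0<m)
    -- The size condition removes the slack of every tree that reads as `π`, so any two preimages
    -- can be compared.
    tight : ∀ {b} (t : Tree b) → postorder t ≡ word π → slack t ≡ 0
    tight t eq = +-cancelˡ-≡ (2 * descents π + 1) _ _
      (trans (sym (length-tight π t eq 1≤n)) (trans size (sym (+-identityʳ _))))
    all-equal : (p q : s⁻¹ π) → p ≡ q
    all-equal p q with preimage-tree p | preimage-tree q
    ... | _ , t , t-word , t-post | _ , u , u-word , u-post = preimage-≡ p q
      (trans (sym t-word) (trans
        (postorder-injective t u (tight t t-post) (tight u u-post) (trans t-post (sym u-post)))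
        u-word))
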